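{- Suppose $k\ge s_A$, $n\ge1$, $i,j\in D$, and $i\Rightarrow_{n+1} j$. Then the algorithm discovers this relation during or before round $n+1$, i.e. $(i,j)\in\mathcal K_{n+1}$.
   Context: Fix integers $k\ge1$, $d\ge1$, $K=\{1,\dots,k\}$, $D=\{1,\dots,d\}$. The $k$-tree is the set $K^*$ of finite words over $K$ with root the empty word $\epsilon$; $xg$ ($g\in K$) are the children of $x$. $L_n$ is the set of words of length exactly $n$ and $\Delta_n$ the set of words of length at most $n$. $A$ is a $d\times d$ matrix with entries in $\{0,1\}$, $S(a)=\{b\in D:A(a,b)=1\}$, and $s_A=\max_{a\in D}\sum_b A(a,b)$ is the maximum row sum. A (valid) labeling of $\Delta_n$ is a map $\lambda:\Delta_n\to D$ with $A(\lambda(x),\lambda(xg))=1$ for all $x\in\Delta_{n-1}$, $g\in K$. For $p,q\in D$, $p\Rightarrow_n q$ means: for every valid labeling $\lambda$ of $\Delta_n$ with $\lambda(\epsilon)=p$ there is a valid labeling $\lambda'$ of $\Delta_n$ with $\lambda'(\epsilon)=q$ and $\lambda'|_{L_n}=\lambda|_{L_n}$. The relation-finding algorithm proceeds in rounds producing sets $\mathcal K_0\subseteq\mathcal K_1\subseteq\cdots$ of pairs in $D\times D$ ("relations known after round $n$"): $\mathcal K_0=\{(a,a):a\in D\}$, and for $n\ge0$, $\mathcal K_{n+1}=\mathcal K_n\cup\{(p,q)\in D\times D: \text{for every } a\in S(p) \text{ there is } b\in S(q) \text{ with } (a,b)\in\mathcal K_n\}$. A relation $p\Rightarrow q$ is discovered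 at round $m$ if $(p,q)\in\mathcal K_m\setminus\mathcal K_{m-1}$.
   Formalization: Adds the hypothesis that some valid labeling of Δ_{n+1} has root label j (automatic if A has no zero row, or if some valid labeling has root i); without it the claim fails for vacuous relations, e.g. k=n=1, D={i,a,j}, only A(i,a)=1. -}

module Defs where

open import Algebra.Properties.CommutativeMonoid.Sum using (sum)
open import Data.Fin.Base using (Fin; toℕ)
open import Data.Fin.Patterns using (1F)
open import Data.List.Base using (List; []; _∷_; _∷ʳ_; length; map; allFin)
open import Data.List.Extrema.Nat using (max)
open import Data.Nat.Base using (ℕ; zero; suc; _≤_; _<_; z≤n; s≤s)
open import Data.Nat.Properties using (+-0-commutativeMonoid; <⇒≤)
open import Data.Product.Base using (∃; _×_)
open import Data.Sum.Base using (_⊎_)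
open import Level using (0ℓ)
open import Relation.Binary.Core using (Rel)
open import Relation.Binary.PropositionalEquality using (_≡_)
open import Relation.Unary using (Pred; _∈_)

Matrix₀₁ : ℕ → Set
Matrix₀₁ d = Fin d → Fin d → Fin 2

S : ∀ {d} → Matrix₀₁ d → Fin d → Pred (Fin d) 0ℓ
S A a b = A a b ≡ 1F

rowSum : ∀ {d} → Matrix₀₁ d → Fin d → ℕ
rowSum A a = sum +-0-commutativeMonoid (λ b → toℕ (A a b))

-- The default 0 does not affect the maximum, since row sums are natural numbers.
maxRowSum : ∀ {d} → Matrix₀₁ d → ℕ
maxRowSum {d} A = max 0 (map (rowSum A) (allFin d))

-- The child xg of a word x is x ∷ʳ g: the root is at the head of the list.
Word : ℕ → Set
Word k = List (Fin k)

infixr 4 _,_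

-- The bound is irrelevant, so that a function on Δ k n depends on the word only.
record Δ (k n : ℕ) : Set where
  constructor _,_
  field
    word   : Word k
    .bound : length word ≤ n

open Δ public

root : ∀ {k n} → Δ k n
root = [] , z≤n

length-child : ∀ {k n} (x : Word k) (g : Fin k) → length x < n → length (x ∷ʳ g) ≤ n
length-child []      g (s≤s _) = s≤s z≤n
length-child (_ ∷ x) g (s≤s p) = s≤s (length-child x g p)

-- The condition length x < n says x ∈ Δₙ₋₁, with Δ₋₁ empty.
Valid : ∀ {d} → Matrix₀₁ d → (k n : ℕ) → (Δ k n → Fin d) → Set
Valid A k n ℓ = ∀ (x : Word k) (g : Fin k) (x<n : length x < n) →
  A (ℓ (x , <⇒≤ x<n)) (ℓ (x ∷ʳ g , length-child x g x<n)) ≡ 1F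

AgreeOnLevel : ∀ {d} (k n : ℕ) → Rel (Δ k n → Fin d) 0ℓ
AgreeOnLevel k n ℓ′ ℓ = ∀ x → length (word x) ≡ n → ℓ′ x ≡ ℓ x

-- The relation p ⇒ₙ q.
Implies : ∀ {d} → Matrix₀₁ d → (k n : ℕ) → Rel (Fin d) 0ℓ
Implies {d} A k n p q = ∀ (ℓ : Δ k n → Fin d) → Valid A k n ℓ → ℓ root ≡ p →
  ∃ λ (ℓ′ : Δ k n → Fin d) → Valid A k n ℓ′ × ℓ′ root ≡ q × AgreeOnLevel k n ℓ′ ℓ

-- If A has zero rows, there may be no valid labeling of Δₙ with root q. If p has none
-- either, then p ⇒ₙ q holds vacuously, and the algorithm need not discover it: for
-- k = 1 and a 3 × 3 matrix over {i, a, j} whose only nonzero entry is A(i,a), one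
-- has s_A = 1 and i ⇒₂ j, but (i , j) is in no 𝒦ₘ because S(j) is empty and S(i) is not.
-- Every q is a root label when A has no zero row.
RootLabel : ∀ {d} → Matrix₀₁ d → (k n : ℕ) → Pred (Fin d) 0ℓ
RootLabel {d} A k n q = ∃ λ (ℓ : Δ k n → Fin d) → Valid A k n ℓ × ℓ root ≡ q

-- Known A n p q means (p , q) ∈ 𝒦ₙ.
Known : ∀ {d} → Matrix₀₁ d → ℕ → Rel (Fin d) 0ℓ
Known A zero    p q = p ≡ q
Known A (suc n) p q =
  Known A n p q ⊎ (∀ a → a ∈ S A p → ∃ λ b → b ∈ S A q × Known A n a b)

{-# OPTIONS --safe #-}

-- Suppose (p , q) is not in 𝒦ₙ₊₁. Then some a ∈ S(p) has (a , b) ∉ 𝒦ₙ for every b ∈ S(q),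
-- but different b may need different labelings below a to be refuted. So one refutes k
-- roots q₁ , … , q_k at once: below a root p unrelated to all of them, the child g receives
-- the witness a_g against q_g and, recursively, a labeling that refutes all successors of
-- q_g simultaneously, of which there are at most s_A ≤ k. A labeling with root q_g and the
-- same last level would restrict to the subtree of g and have a successor of q_g there.
-- Since rows may be zero, only successors that start a walk of the remaining length are
-- refuted; no others occur as labels, and each q_g has at least one.
module Submission where

open import Defs
open import Data.Fin.Base using (Fin; zero; suc; toℕ; fromℕ<)
open import Data.Fin.Patterns using (1F)
open import Data.Fin.Properties using (_≟_; all?; any?; ¬∀⟶∃¬)
open import Data.List.Base using (List; []; _∷_; length; filter; tabulate; allFin)
open import Data.List.Extrema.Nat using (xs≤max)
import Data.List.Membership.Propositional as List
open import Data.List.Membership.Propositional.Properties using (∈-allFin; ∈-filter⁺)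
open import Data.List.Relation.Unary.All as All using (All; []; _∷_)
open import Data.List.Relation.Unary.All.Properties using (all-filter; map⁻)
open import Data.List.Relation.Unary.Any using (here; there)
open import Data.Nat.Base using (ℕ; zero; suc; _≤_; _≥_; z≤n; s≤s; s≤s⁻¹)
open import Data.Nat.Properties using (+-0-commutativeMonoid; ≤-trans; m≤n+m)
open import Algebra.Properties.CommutativeMonoid.Sum +-0-commutativeMonoid using (sum)
open import Data.Product.Base using (∃; _×_; proj₁; proj₂) renaming (_,_ to _,,_)
open import Data.Sum.Base using (inj₁; inj₂)
open import Data.Unit.Base using (⊤; tt)
open import Function.Base using (_∘_; const; id)
open import Relation.Binary.Definitions using () renaming (Decidable to Decidable₂)
open import Relation.Binary.PropositionalEquality using (_≡_; refl; sym; trans; cong; subst)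
open import Relation.Nullary using (¬_; yes; no)
open import Relation.Nullary.Decidable using (_×-dec_; _⊎-dec_; _→-dec_; decidable-stable)
open import Relation.Nullary.Negation using (contradiction)
open import Relation.Unary using (Pred; Decidable; _∈_; _⊆_)

-- Turns a list into a family indexed by `Fin k`; a short list is padded with `x`, which is harmless
-- wherever `x` has the property required of the entries.
lookupOr : ∀ {a} {X : Set a} {k} → X → List X → Fin k → X
lookupOr x []       _       = x
lookupOr x (y ∷ _)  zero    = y
lookupOr x (_ ∷ ys) (suc g) = lookupOr x ys g

lookupOr⁺ : ∀ {a p} {X : Set a} {P : Pred X p} {k x xs} → P x → All P xs →
  (g : Fin k) → P (lookupOr x xs g)
lookupOr⁺ px []         _       = px
lookupOr⁺ px (py ∷ _)   zero    = py
lookupOr⁺ px (_  ∷ pys) (suc g) = lookupOr⁺ px pys g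

lookupOr-surjective : ∀ {a} {X : Set a} {k x y} {xs : List X} → length xs ≤ k →
  y List.∈ xs → ∃ λ (g : Fin k) → lookupOr x xs g ≡ y
lookupOr-surjective (s≤s _) (here refl) = zero ,, refl
lookupOr-surjective (s≤s l) (there y∈)  =
  let g ,, eq = lookupOr-surjective l y∈ in suc g ,, eq

-- Each element kept has `u`-value 1 and so contributes 1 to the sum. A general `f` lets the
-- induction pass to `f ∘ suc`.
length-filter-tabulate : ∀ {p m} {X : Set} {P : Pred X p} (P? : Decidable P) (u : X → Fin 2) →
  (∀ {x} → P x → u x ≡ 1F) → (f : Fin m → X) →
  length (filter P? (tabulate f)) ≤ sum (toℕ ∘ u ∘ f)
length-filter-tabulate {m = zero}  P? u P⇒1 f = z≤n
length-filter-tabulate {m = suc m} P? u P⇒1 f with P? (f zero)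
... | yes pf rewrite P⇒1 pf = s≤s (length-filter-tabulate P? u P⇒1 (f ∘ suc))
... | no _ = ≤-trans (length-filter-tabulate P? u P⇒1 (f ∘ suc)) (m≤n+m _ (toℕ (u (f zero))))

module _ {d : ℕ} (A : Matrix₀₁ d) where

  S? : ∀ a → Decidable (S A a)
  S? a b = A a b ≟ 1F

  rowSum≤maxRowSum : ∀ a → rowSum A a ≤ maxRowSum A
  rowSum≤maxRowSum a = All.lookup (map⁻ (xs≤max 0 _)) (∈-allFin a)

  -- This is where `maxRowSum A ≤ k` enters: a subset of a row of `A` has at most k elements, so one
  -- child can be assigned to each. The given element of `P` serves as padding.
  enumerate : ∀ {p k} {P : Pred (Fin d) p} → maxRowSum A ≤ k → Decidable P →
    ∀ {a} → P ⊆ S A a → ∃ P →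
    ∃ λ (h : Fin k → Fin d) → (∀ g → P (h g)) × (∀ {b} → P b → ∃ λ g → h g ≡ b)
  enumerate s≤k P? {a} P⊆S (b₀ ,, pb₀) =
    lookupOr b₀ (filter P? (allFin d)) ,,
    lookupOr⁺ pb₀ (all-filter P? (allFin d)) ,,
    λ pb → lookupOr-surjective
      (≤-trans (length-filter-tabulate P? (A a) P⊆S id) (≤-trans (rowSum≤maxRowSum a) s≤k))
      (∈-filter⁺ P? (∈-allFin _) pb)

  -- A necessary condition on the label of a vertex that lies n levels above the last one.
  Walk : ℕ → Pred (Fin d) _
  Walk zero    _ = ⊤
  Walk (suc n) a = ∃ λ b → b ∈ S A a × Walk n b

  Walk? : ∀ n → Decidable (Walk n)
  Walk? zero    _ = yes tt
  Walk? (suc n) a = any? λ b → S? a b ×-dec Walk? n b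

  Known? : ∀ n → Decidable₂ (Known A n)
  Known? zero    = _≟_
  Known? (suc n) p q =
    Known? n p q ⊎-dec all? λ a → S? p a →-dec any? λ b → S? q b ×-dec Known? n a b

  -- The test of each round ranges over finite sets and is decidable, so its failure yields an
  -- explicit `a` constructively.
  ¬Known⇒witness : ∀ {n p q} → ¬ Known A (suc n) p q →
    ∃ λ a → a ∈ S A p × (∀ {b} → b ∈ S A q → ¬ Known A n a b)
  ¬Known⇒witness {n} {p} {q} ¬K
    with a ,, ¬Pa ← ¬∀⟶∃¬ d _ (λ a → S? p a →-dec any? λ b → S? q b ×-dec Known? n a b)
                          (¬K ∘ inj₂)
    = a
    ,, decidable-stable (S? p a) (λ a∉S → ¬Pa λ a∈S → contradiction a∈S a∉S)
    ,, λ b∈S K → ¬Pa λ _ → _ ,, b∈S ,, K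

  module _ {k : ℕ} where

    -- Words grow at the end, so prepending `g` embeds the tree as the subtree of the child g and
    -- commutes with taking children by computation.
    below : ∀ {n} → Fin k → Δ k n → Δ k (suc n)
    below g (w , b) = g ∷ w , s≤s b

    graft : ∀ {n} → Fin d → (Fin k → Δ k n → Fin d) → Δ k (suc n) → Fin d
    graft p ℓ ([]    , _) = p
    graft p ℓ (g ∷ w , b) = ℓ g (w , s≤s⁻¹ b)

    graft-valid : ∀ {n p} {ℓ : Fin k → Δ k n → Fin d} → (∀ g → ℓ g root ∈ S A p) →
      (∀ g → Valid A k n (ℓ g)) → Valid A k (suc n) (graft p ℓ)
    graft-valid r v []      g _         = r g
    graft-valid r v (h ∷ x) g (s≤s x<n) = v h x g x<n

    below-valid : ∀ {n} (ℓ : Δ k (suc n) → Fin d) → Valid A k (suc n) ℓ →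
      ∀ g → Valid A k n (ℓ ∘ below g)
    below-valid ℓ v g x h x<n = v (g ∷ x) h (s≤s x<n)

    below-root : ∀ {n} (ℓ : Δ k (suc n) → Fin d) → Valid A k (suc n) ℓ →
      ∀ g → ℓ (below g root) ∈ S A (ℓ root)
    below-root ℓ v g = v [] g (s≤s z≤n)

    -- Read the labels along the branch that always takes the child `g`.
    valid⇒Walk : ∀ {n} → Fin k → (ℓ : Δ k n → Fin d) → Valid A k n ℓ → Walk n (ℓ root)
    valid⇒Walk {zero}  g ℓ v = tt
    valid⇒Walk {suc n} g ℓ v =
      _ ,, below-root ℓ v g ,, valid⇒Walk g (ℓ ∘ below g) (below-valid ℓ v g)

    Refutes : ∀ n → (Δ k n → Fin d) → Pred (Fin d) _
    Refutes n ℓ q = ∀ ℓ′ → Valid A k n ℓ′ → ℓ′ root ≡ q → ¬ AgreeOnLevel k n ℓ′ ℓ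

    simultaneous-refutation : maxRowSum A ≤ k → ∀ n p (q : Fin k → Fin d) →
      (∀ g → Walk n (q g)) → (∀ g → ¬ Known A n p (q g)) →
      ∃ λ ℓ → Valid A k n ℓ × ℓ root ≡ p × (∀ g → Refutes n ℓ (q g))
    simultaneous-refutation s≤k zero p q _ ¬K =
      -- The root is itself the last level here, so agreement would force `p ≡ q g`.
      const p ,, (λ _ _ ()) ,, refl ,,
      λ g ℓ′ _ root≡q agree → ¬K g (trans (sym (agree root refl)) root≡q)
    simultaneous-refutation s≤k (suc n) p q walk ¬K =
      graft p ℓ ,,
      graft-valid (λ g → subst (S A p) (sym (ℓ-root g)) (a∈S g)) ℓ-valid ,,
      refl ,, refutes
      where
      a : Fin k → Fin d
      a g = proj₁ (¬Known⇒witness (¬K g))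

      a∈S : ∀ g → a g ∈ S A p
      a∈S g = proj₁ (proj₂ (¬Known⇒witness (¬K g)))

      successors : ∀ g → ∃ λ (h : Fin k → Fin d) →
        (∀ g′ → h g′ ∈ S A (q g) × Walk n (h g′)) ×
        (∀ {b} → b ∈ S A (q g) × Walk n b → ∃ λ g′ → h g′ ≡ b)
      successors g = enumerate s≤k (λ b → S? (q g) b ×-dec Walk? n b) proj₁ (walk g)

      subtree : ∀ g → ∃ λ ℓ → Valid A k n ℓ × ℓ root ≡ a g ×
        (∀ g′ → Refutes n ℓ (proj₁ (successors g) g′))
      subtree g =
        let h ,, h∈ ,, _ = successors g in
        simultaneous-refutation s≤k n (a g) h (proj₂ ∘ h∈)
          -- The witness `a g` is unrelated at round n to every successor of `q g`, as the induction
          -- hypothesis demands.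
          (λ g′ → proj₂ (proj₂ (¬Known⇒witness (¬K g))) (proj₁ (h∈ g′)))

      ℓ : Fin k → Δ k n → Fin d
      ℓ g = proj₁ (subtree g)

      ℓ-valid : ∀ g → Valid A k n (ℓ g)
      ℓ-valid g = proj₁ (proj₂ (subtree g))

      ℓ-root : ∀ g → ℓ g root ≡ a g
      ℓ-root g = proj₁ (proj₂ (proj₂ (subtree g)))

      refutes : ∀ g → Refutes (suc n) (graft p ℓ) (q g)
      refutes g ℓ′ v root≡q agree =
        let _ ,, _ ,, covers = successors g
            -- The label that `ℓ′` gives to the child g follows `q g` and starts a walk, so it is
            -- one of the roots that `ℓ g` refutes.
            c∈S = subst (λ r → ℓ′ (below g root) ∈ S A r) root≡q (below-root ℓ′ v g)
            g′ ,, eq = covers (c∈S ,, valid⇒Walk g (ℓ′ ∘ below g) (below-valid ℓ′ v g))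
        in proj₂ (proj₂ (proj₂ (subtree g))) g′ (ℓ′ ∘ below g) (below-valid ℓ′ v g) (sym eq)
             (λ x len → agree (below g x) (cong suc len))

    Implies⇒Known : Fin k → maxRowSum A ≤ k → ∀ {n p q} → q ∈ RootLabel A k n →
      Implies A k n p q → Known A n p q
    Implies⇒Known g s≤k {n} {p} {q} (ℓ₀ ,, v₀ ,, root≡q) p⇒q =
      decidable-stable (Known? n p q) λ ¬K →
        -- For a single root all children get the same task; the given labeling with root `q`
        -- supplies the walk.
        let ℓ ,, v ,, root≡p ,, refutes = simultaneous-refutation s≤k n p (const q)
              (λ _ → subst (Walk n) root≡q (valid⇒Walk g ℓ₀ v₀)) (λ _ → ¬K)
            ℓ′ ,, v′ ,, root′≡q ,, agree = p⇒q ℓ v root≡p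
        in refutes g ℓ′ v′ root′≡q agree

theorem5p6 : ∀ (k d : ℕ) → k ≥ 1 → d ≥ 1 → (A : Matrix₀₁ d) → k ≥ maxRowSum A →
    ∀ (n : ℕ) → n ≥ 1 → (i j : Fin d) → j ∈ RootLabel A k (suc n) →
    Implies A k (suc n) i j → Known A (suc n) i j
theorem5p6 k d k≥1 _ A k≥s n _ i j = Implies⇒Known A (fromℕ< k≥1) k≥s
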